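{- For every integer $n\ge 1$, $$|RAI_{2n}(2431,4132)|=|RAI_{2n}(3241,4213)|=|RAI_{2n+1}(3241,4213)|=|AI_{2n+1}(2431,4132)|=2^{n-1}.$$
   Context: Let $S_n$ be the set of permutations $\pi=\pi_1\ldots\pi_n$ of $\{1,\ldots,n\}$. A permutation is alternating if, for all $1\le i\le n-1$, $\pi_i<\pi_{i+1}$ if and only if $i$ is odd; it is reverse alternating if, for all $1\le i\le n-1$, $\pi_i>\pi_{i+1}$ if and only if $i$ is odd. $AI_n$ (resp. $RAI_n$) is the set of alternating (resp. reverse alternating) involutions ($\pi=\pi^{ -1}$) in $S_n$. A permutation $\pi\in S_n$ avoids the pattern $\tau\in S_k$ if there are no indices $i_1<\cdots<i_k$ such that $\pi_{i_1}\ldots\pi_{i_k}$ is order-isomorphic to $\tau$; $AI_n(\sigma,\tau)$ and $RAI_n(\sigma,\tau)$ are the subsets of elements avoiding both $\sigma$ and $\tau$. (Since $4132=2431^{ -1}$ and $4213=3241^{ -1}$, for involutions avoiding both patterns of a pair is the same as avoiding either one.) -}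

module Defs where

open import Data.Fin.Base using (Fin; toℕ; _<_)
open import Data.Fin.Patterns using (0F; 1F; 2F; 3F)
open import Data.Fin.Permutation using (Permutation′; permutation; flip; _⟨$⟩ʳ_; _≈_)
open import Data.Fin.Properties using (_≟_; all?)
open import Data.Nat.Base using (ℕ; suc)
open import Data.Nat.Divisibility using (_∣_)
open import Data.Product.Base using (∃; Σ-syntax; _×_; proj₁)
open import Data.Vec.Base using (Vec; []; _∷_; lookup)
open import Function.Bundles using (_⇔_; Inverse)
open import Level using (0ℓ)
open import Relation.Binary.Bundles using (Setoid)
import Relation.Binary.Construct.On as On
open import Relation.Binary.PropositionalEquality using (_≡_; setoid; _→-setoid_)
open import Relation.Nullary.Decidable using (True; toWitness)
open import Relation.Nullary.Negation using (¬_)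
open import Relation.Unary using (Pred)

-- Positions and values are 0-based: the i-th letter (i = 1, …, n) sits at the
-- element of Fin n with toℕ equal to i ∸ 1, so 'suc (toℕ i)' below is the
-- usual 1-based position.

Alternating : ∀ {n} → Pred (Permutation′ n) 0ℓ
Alternating π = ∀ i j → toℕ j ≡ suc (toℕ i) →
  (π ⟨$⟩ʳ i) < (π ⟨$⟩ʳ j) ⇔ (¬ 2 ∣ suc (toℕ i))

ReverseAlternating : ∀ {n} → Pred (Permutation′ n) 0ℓ
ReverseAlternating π = ∀ i j → toℕ j ≡ suc (toℕ i) →
  (π ⟨$⟩ʳ j) < (π ⟨$⟩ʳ i) ⇔ (¬ 2 ∣ suc (toℕ i))

Involution : ∀ {n} → Pred (Permutation′ n) 0ℓ
Involution π = π ≈ flip π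

Contains : ∀ {k n} → Permutation′ k → Pred (Permutation′ n) 0ℓ
Contains {k} {n} τ π = Σ[ ι ∈ (Fin k → Fin n) ]
  (∀ a b → a < b → ι a < ι b) ×
  (∀ a b → (π ⟨$⟩ʳ ι a) < (π ⟨$⟩ʳ ι b) ⇔ (τ ⟨$⟩ʳ a) < (τ ⟨$⟩ʳ b))

Avoids : ∀ {k n} → Permutation′ k → Pred (Permutation′ n) 0ℓ
Avoids τ π = ¬ Contains τ π

AI : ∀ {k l} (n : ℕ) → Permutation′ k → Permutation′ l → Pred (Permutation′ n) 0ℓ
AI n σ τ π = Alternating π × Involution π × Avoids σ π × Avoids τ π

RAI : ∀ {k l} (n : ℕ) → Permutation′ k → Permutation′ l → Pred (Permutation′ n) 0ℓ
RAI n σ τ π = ReverseAlternating π × Involution π × Avoids σ π × Avoids τ π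

-- Members of a set of permutations are identified when they agree at every
-- position; the membership proofs and the inverse maps stored in
-- 'Permutation′' are ignored.

members : ∀ {n} → Pred (Permutation′ n) 0ℓ → Setoid 0ℓ 0ℓ
members {n} P = On.setoid {B = ∃ P} (Fin n →-setoid Fin n) (λ p → proj₁ p ⟨$⟩ʳ_)

HasCardinality : ∀ {n} → Pred (Permutation′ n) 0ℓ → ℕ → Set
HasCardinality P m = Inverse (members P) (setoid (Fin m))

-- The permutation with one-line notation w, where v is the one-line notation
-- of its inverse.

oneLine : ∀ {k} (w v : Vec (Fin k) k)
          {_ : True (all? λ i → lookup w (lookup v i) ≟ i)}
          {_ : True (all? λ i → lookup v (lookup w i) ≟ i)} →
          Permutation′ k
oneLine w v {wv} {vw} = permutation (lookup w) (lookup v) (toWitness wv) (toWitness vw)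

-- The names carry the usual 1-based letters; the entries are lower by one.

w2431 w4132 w3241 w4213 : Vec (Fin 4) 4
w2431 = 1F ∷ 3F ∷ 2F ∷ 0F ∷ []
w4132 = 3F ∷ 0F ∷ 2F ∷ 1F ∷ []
w3241 = 2F ∷ 1F ∷ 3F ∷ 0F ∷ []
w4213 = 3F ∷ 1F ∷ 0F ∷ 2F ∷ []

p2431 p4132 p3241 p4213 : Permutation′ 4
p2431 = oneLine w2431 w4132
p4132 = oneLine w4132 w2431
p3241 = oneLine w3241 w4213
p4213 = oneLine w4213 w3241

{-# OPTIONS --safe #-}
module Submission where

-- Reverse-complement exchanges {2431, 4132} with {4213, 3241}; it preserves reverse
-- alternation in even length and exchanges it with alternation in odd length, so it
-- is enough to count RAI_N(3241, 4213) for N = 2n and N = 2n + 1.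
--
-- Number positions and values from 0 and let m = π(0), so that π(m) = 0. Then m is a
-- valley, hence m = 2k + 1. Two successive peaks before m cannot increase: with the
-- valley between them and the letter 0 at m they would form 3241. So the peaks up to m
-- decrease, π maps {0, …, m} to itself, and placing the largest values one after the
-- other forces the first m + 1 letters to be m, m-2, m-1, m-4, m-3, …, 1, 2, 0.
-- Hence π is a direct sum of such blocks, followed by a fixed point when N is odd, and
-- conversely every such sum qualifies, because inside a block only neighbouring letters
-- form an ascent. The block lengths give the 2^(n-1) compositions of n.

open import Defs
open import Data.Bool.Base using (Bool; true; false)
open import Data.Fin.Base as Fin using (Fin; toℕ; fromℕ<; inject₁; opposite)
open import Data.Fin.Patterns using (0F; 1F; 2F; 3F)
open import Data.Fin.Permutation as Perm
  using (Permutation′; permutation; _⟨$⟩ʳ_; _⟨$⟩ˡ_; flip; reverse; _∘ₚ_)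
open import Data.Fin.Properties as Fin
  using (toℕ<n; toℕ-injective; toℕ-fromℕ<; fromℕ<-toℕ; opposite-prop; opposite-involutive; *↔×; 2↔Bool)
open import Data.Nat.Base
  using (ℕ; zero; suc; _≤_; _<_; _+_; _*_; _∸_; _^_; z≤n; s≤s; s≤s⁻¹; s<s⁻¹; z<s)
open import Data.Nat.Divisibility using (_∣_; ∣m+n∣m⇒∣n; ∣1⇒≡1; n∣m*n; ∣m∣n⇒∣m+n)
open import Data.Nat.Properties
open import Algebra.Properties.CommutativeSemigroup +-commutativeSemigroup using (x∙yz≈y∙xz)
open import Data.Product.Base using (_×_; _,_; ∃; proj₁; proj₂)
open import Data.Product.Function.NonDependent.Propositional using (_×-↔_)
open import Data.Sum.Base using (inj₁; inj₂)
open import Data.Vec.Base using (Vec; []; _∷_; lookup)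
open import Function.Base using (id; _∘_)
open import Function.Bundles using (_⇔_; mk⇔; _↔_; mk↔ₛ′; Equivalence; Inverse; Bijection)
open import Function.Construct.Composition as Compose using (_↔-∘_; _⇔-∘_)
open import Function.Construct.Symmetry as Symmetry using (⇔-sym; ↔-sym)
open import Function.Properties.Bijection using (Bijection⇒Inverse)
open import Function.Related.TypeIsomorphisms using (¬-cong-⇔)
open import Level using (0ℓ)
open import Relation.Binary.Definitions using (tri<; tri≈; tri>)
open import Relation.Binary.PropositionalEquality
open import Relation.Nullary.Decidable using (yes; no)
open import Relation.Nullary.Negation using (¬_; contradiction)
open import Relation.Unary using (Pred)

-- Parity and doubling.

data Parity : ℕ → Set where
  even : ∀ j → Parity (j * 2)
  odd  : ∀ j → Parity (suc (j * 2))

parity? : ∀ x → Parity x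
parity? zero = even 0
parity? (suc x) with parity? x
... | even j = odd j
... | odd j  = even (suc j)

halve-< : ∀ {i j} → i * 2 < j * 2 → i < j
halve-< {i} {j} = *-cancelʳ-< 2 i j

halve-≤ : ∀ {i j} → i * 2 ≤ j * 2 → i ≤ j
halve-≤ {i} {j} = *-cancelʳ-≤ i j 2

double-≤ : ∀ {i j} → i ≤ j → i * 2 ≤ j * 2
double-≤ = *-monoˡ-≤ 2

double-< : ∀ {i j} → i < j → suc (i * 2) < j * 2
double-< = double-≤

double-+ : ∀ c k j → c + suc (k + j) * 2 ≡ suc k * 2 + (c + j * 2)
double-+ c k j = trans (cong (c +_) (*-distribʳ-+ 2 (suc k) j)) (x∙yz≈y∙xz c (suc k * 2) (j * 2))

-- Plain functions on ℕ, constrained only below `N`, make translation by a block length ordinary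
-- addition. Peaks sit at even positions; avoidance of 4213, the inverse of 3241, follows by
-- involutivity.
record Admissible (N : ℕ) (f : ℕ → ℕ) : Set where
  field
    bounded    : ∀ {x} → x < N → f x < N
    involutive : ∀ {x} → x < N → f (f x) ≡ x
    descent    : ∀ j → suc (j * 2) < N → f (suc (j * 2)) < f (j * 2)
    ascent     : ∀ j → suc j * 2 < N → f (suc (j * 2)) < f (suc j * 2)
    no-3241    : ∀ {a b c d} → a < b → b < c → c < d → d < N →
                 f b < f a → f a < f c → ¬ f d < f b

-- 'k ▷ g' is the direct sum of the word m, m-2, m-1, m-4, m-3, …, 1, 2, 0,
-- where m = 2k+1, and of the word of g.

private
  -- Deleting the leading pair from the tail of a block leaves the tail of the next shorter block.
  -- `h` arrives already translated, so the recursion passes it on unchanged.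
  below : ℕ → (ℕ → ℕ) → ℕ → ℕ
  below zero    h zero          = 0
  below zero    h (suc x)       = h x
  below (suc k) h zero          = suc (k * 2)
  below (suc k) h (suc zero)    = suc k * 2
  below (suc k) h (suc (suc x)) = below k h x

infixr 5 _▷_

_▷_ : ℕ → (ℕ → ℕ) → ℕ → ℕ
(k ▷ g) zero    = suc (k * 2)
(k ▷ g) (suc x) = below k (λ y → suc k * 2 + g y) x

-- Writing the index relation as `j + suc j′ ≡ k` avoids subtraction and shows the symmetry:
-- exchanging `j` and `j′` exchanges position and value, just as `first` and `last` are exchanged.
data Graph (k : ℕ) (h : ℕ → ℕ) : ℕ → ℕ → Set where
  first    : Graph k h 0 (suc (k * 2))
  inner₁   : ∀ {j j′} → j + suc j′ ≡ k → Graph k h (suc (j * 2)) (suc (j′ * 2))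
  inner₂   : ∀ {j j′} → j + suc j′ ≡ k → Graph k h (suc j * 2) (suc j′ * 2)
  last     : Graph k h (suc (k * 2)) 0
  beyond   : ∀ x → Graph k h (suc k * 2 + x) (h x)

below-graph : ∀ k h x → Graph k h (suc x) (below k h x)
below-graph zero    h zero          = last
below-graph zero    h (suc x)       = beyond x
below-graph (suc k) h zero          = inner₁ {j = 0} {k} refl
below-graph (suc k) h (suc zero)    = inner₂ {j = 0} {k} refl
below-graph (suc k) h (suc (suc x)) = shift (below-graph k h x)
  where
  shift : ∀ {y} → Graph k h (suc x) y → Graph (suc k) h (suc (suc (suc x))) y
  shift (inner₁ e) = inner₁ (cong suc e)
  shift (inner₂ e) = inner₂ (cong suc e)
  shift last       = last
  shift (beyond x) = beyond x

graph : ∀ k g x → Graph k (λ y → suc k * 2 + g y) x ((k ▷ g) x)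
graph k g zero    = first
graph k g (suc x) = below-graph k _ x

below-inner₁ : ∀ {h} j {j′ k} → j + suc j′ ≡ k → below k h (j * 2) ≡ suc (j′ * 2)
below-inner₁ zero    refl = refl
below-inner₁ (suc j) refl = below-inner₁ j refl

below-inner₂ : ∀ {h} j {j′ k} → j + suc j′ ≡ k → below k h (suc (j * 2)) ≡ suc j′ * 2
below-inner₂ zero    refl = refl
below-inner₂ (suc j) refl = below-inner₂ j refl

below-last : ∀ {h} k → below k h (k * 2) ≡ 0
below-last zero    = refl
below-last (suc k) = below-last k

below-beyond : ∀ {h} k x → below k h (suc (k * 2) + x) ≡ h x
below-beyond zero    x = refl
below-beyond (suc k) x = below-beyond k x

graph⇒≡ : ∀ {k g x y} → Graph k (λ y → suc k * 2 + g y) x y → (k ▷ g) x ≡ y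
graph⇒≡ first               = refl
graph⇒≡ (inner₁ {j} e)      = below-inner₁ j e
graph⇒≡ (inner₂ {j} e)      = below-inner₂ j e
graph⇒≡ {k} last            = below-last k
graph⇒≡ {k} (beyond x)      = below-beyond k x

swap-sum : ∀ {k} j j′ → j + suc j′ ≡ k → j′ + suc j ≡ k
swap-sum j j′ e = trans (+-suc j′ j) (trans (cong suc (+-comm j′ j)) (trans (sym (+-suc j j′)) e))

-- Direct sums with a block preserve admissibility.

▷-involutive : ∀ k {g N x} → (∀ {y} → y < N → g (g y) ≡ y) →
               x < suc k * 2 + N → (k ▷ g) ((k ▷ g) x) ≡ x
▷-involutive k {g} {N} {x} g-inv x<N = from-graph (graph k g x) x<N
  where
  from-graph : ∀ {x y} → Graph k _ x y → x < suc k * 2 + N → (k ▷ g) y ≡ x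
  from-graph first              _ = graph⇒≡ {k} {g} last
  from-graph (inner₁ {j} {j′} e) _ = graph⇒≡ (inner₁ (swap-sum j j′ e))
  from-graph (inner₂ {j} {j′} e) _ = graph⇒≡ (inner₂ (swap-sum j j′ e))
  from-graph last               _ = refl
  from-graph (beyond y)         l = trans (graph⇒≡ {k} {g} (beyond (g y)))
    (cong (suc k * 2 +_) (g-inv (+-cancelˡ-< (suc k * 2) y N l)))

inner-bound : ∀ {j j′ k} → j + suc j′ ≡ k → suc j * 2 ≤ k * 2
inner-bound {j} {j′} e = double-≤ (subst (suc j ≤_) (trans (sym (+-suc j j′)) e) (s≤s (m≤m+n j j′)))

data Within (k : ℕ) (h : ℕ → ℕ) : ℕ → ℕ → Set where
  inside  : ∀ {x y} → x < suc k * 2 → y < suc k * 2 → Graph k h x y → Within k h x y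
  outside : ∀ x → Within k h (suc k * 2 + x) (h x)

within : ∀ {k h x y} → Graph k h x y → Within k h x y
within first      = inside z<s ≤-refl first
within g@(inner₁ {j} {j′} e) =
  inside (≤-trans (inner-bound e) (m≤n+m _ 2))
         (≤-trans (inner-bound (swap-sum j j′ e)) (m≤n+m _ 2)) g
within g@(inner₂ {j} {j′} e) =
  inside (s≤s (≤-trans (inner-bound e) (n≤1+n _)))
         (s≤s (≤-trans (inner-bound (swap-sum j j′ e)) (n≤1+n _))) g
within last       = inside ≤-refl z<s last
within (beyond x) = outside x

▷-bounded : ∀ k {g N x} → (∀ {y} → y < N → g y < N) →
            x < suc k * 2 + N → (k ▷ g) x < suc k * 2 + N
▷-bounded k {g} {N} {x} g-bd x<N with (k ▷ g) x | within (graph k g x)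
... | _ | inside _ y< _ = ≤-trans y< (m≤m+n _ N)
... | _ | outside y = +-monoʳ-< (suc k * 2) (g-bd (+-cancelˡ-< (suc k * 2) y N x<N))

▷-descent : ∀ k {g N} → (∀ j → suc (j * 2) < N → g (suc (j * 2)) < g (j * 2)) →
            ∀ j → suc (j * 2) < suc k * 2 + N → (k ▷ g) (suc (j * 2)) < (k ▷ g) (j * 2)
▷-descent k {g} {N} g-des = λ
  { zero    _ → top k
  ; (suc j) l → tail k j (λ i → +-monoʳ-< (suc k * 2) ∘ g-des i) (s≤s⁻¹ (s≤s⁻¹ l)) }
  where
  top : ∀ {h} k → below k h 0 < suc (k * 2)
  top zero    = z<s
  top (suc k) = s≤s (n≤1+n _)
  -- `below` starts at position 1 of the word, so peaks have odd arguments here.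
  tail : ∀ {h} k j → (∀ j → suc (j * 2) < N → h (suc (j * 2)) < h (j * 2)) →
         suc (j * 2) < k * 2 + N → below k h (suc j * 2) < below k h (suc (j * 2))
  tail zero    j       h-des l = h-des j l
  tail (suc k) zero    h-des l = s≤s (≤-trans (<⇒≤ (top k)) ≤-refl)
  tail (suc k) (suc j) h-des l = tail k j h-des (s≤s⁻¹ (s≤s⁻¹ l))

▷-ascent : ∀ k {g N} → (∀ j → suc j * 2 < N → g (suc (j * 2)) < g (suc j * 2)) →
           ∀ j → suc j * 2 < suc k * 2 + N → (k ▷ g) (suc (j * 2)) < (k ▷ g) (suc j * 2)
▷-ascent k {g} {N} g-asc j l =
  tail k j z<s (λ i → +-monoʳ-< (suc k * 2) ∘ g-asc i) (s≤s⁻¹ (s≤s⁻¹ l))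
  where
  -- `0 < h 0` handles the junction, where the last letter 0 of the block meets the first letter of
  -- the next summand.
  tail : ∀ {h} k j → 0 < h 0 → (∀ j → suc j * 2 < N → h (suc (j * 2)) < h (suc j * 2)) →
         j * 2 < k * 2 + N → below k h (j * 2) < below k h (suc (j * 2))
  tail zero    zero    0<h h-asc l = 0<h
  tail zero    (suc j) 0<h h-asc l = h-asc j l
  tail (suc k) zero    0<h h-asc l = ≤-refl
  tail (suc k) (suc j) 0<h h-asc l = tail k j 0<h h-asc (s≤s⁻¹ (s≤s⁻¹ l))

-- Both index pairs have the same sum, so one index falls when the other rises. Hence the inner
-- valleys decrease, and so do the inner peaks.
sums-clash : ∀ {k i i′ j j′} → i + suc i′ ≡ k → j + suc j′ ≡ k → i < j → ¬ i′ < j′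
sums-clash refl e i<j i′<j′ = <-irrefl (sym e) (+-mono-< i<j (s≤s i′<j′))

-- The first letter is the largest and the last the smallest, and `sums-clash` rules out all other
-- ascents except one from a valley `j` to a peak `i`. There `j ≤ i` and `j′ ≤ i′` with equal sums,
-- so both belong to one pair.
ascent⇒adjacent : ∀ {k h x y x′ y′} → Graph k h x y → Graph k h x′ y′ →
                  x′ < suc k * 2 → y′ < suc k * 2 → x < x′ → y < y′ → x′ ≡ suc x
ascent⇒adjacent {k} (beyond x) _ x′< _ x<x′ _ = contradiction (<-trans x<x′ x′<) (≤⇒≯ (m≤m+n _ x))
ascent⇒adjacent {k} _ (beyond x) x′< _ _ _ = contradiction x′< (≤⇒≯ (m≤m+n _ x))
ascent⇒adjacent first _ _ y′< _ y<y′ = contradiction y<y′ (≤⇒≯ (s≤s⁻¹ y′<))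
ascent⇒adjacent last _ x′< _ x<x′ _ = contradiction x<x′ (≤⇒≯ (s≤s⁻¹ x′<))
ascent⇒adjacent (inner₁ _) last _ _ _ ()
ascent⇒adjacent (inner₂ _) last _ _ _ ()
ascent⇒adjacent (inner₁ {j} {j′} e) (inner₁ {i} {i′} e′) _ _ x<x′ y<y′ =
  contradiction (halve-< (s<s⁻¹ y<y′)) (sums-clash e e′ (halve-< (s<s⁻¹ x<x′)))
ascent⇒adjacent (inner₂ {j} {j′} e) (inner₂ {i} {i′} e′) _ _ x<x′ y<y′ =
  contradiction (s<s⁻¹ (halve-< {suc j′} y<y′)) (sums-clash e e′ (s<s⁻¹ (halve-< {suc j} x<x′)))
ascent⇒adjacent (inner₂ {j} {j′} e) (inner₁ {i} {i′} e′) _ _ x<x′ y<y′ =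
  contradiction (halve-≤ {suc j′} (s≤s⁻¹ y<y′)) (sums-clash e e′ (halve-≤ {suc j} (s≤s⁻¹ x<x′)))
ascent⇒adjacent (inner₁ {j} {j′} e) (inner₂ {i} {i′} refl) _ _ x<x′ y<y′ =
  cong (λ j → suc j * 2) (sym (≤-antisym j≤i (≮⇒≥ λ j<i → <-irrefl e (+-mono-<-≤ j<i (s≤s j′≤i′)))))
  where
  j≤i = halve-≤ {j} {i} (s≤s⁻¹ (s≤s⁻¹ x<x′))
  j′≤i′ = halve-≤ {j′} {i′} (s≤s⁻¹ (s≤s⁻¹ y<y′))

-- The letters 3 and 4 form an ascent with a position between them, so they cannot share the block.
-- If only 3 lies in it, then 1 lies beyond the block and is too large. Otherwise the whole
-- occurrence lies in the second summand.
▷-no-3241 : ∀ k {g N} →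
  (∀ {a b c d} → a < b → b < c → c < d → d < N → g b < g a → g a < g c → ¬ g d < g b) →
  ∀ {a b c d} → a < b → b < c → c < d → d < suc k * 2 + N →
  (k ▷ g) b < (k ▷ g) a → (k ▷ g) a < (k ▷ g) c → ¬ (k ▷ g) d < (k ▷ g) b
▷-no-3241 k {g} {N} g-avoids {a} {b} {c} {d} =
  from-graph (within (graph k g a)) (within (graph k g b)) (within (graph k g c)) (within (graph k g d))
  where
  M = suc k * 2
  _⇝_ = Within k (λ y → M + g y)
  later : ∀ {ℓ} {A : Set ℓ} {x y} → M + x < y → y < M → A
  later {x = x} l l′ = contradiction (<-trans l l′) (≤⇒≯ (m≤m+n M x))
  from-graph : ∀ {a b c d a′ b′ c′ d′} → a ⇝ a′ → b ⇝ b′ → c ⇝ c′ → d ⇝ d′ →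
    a < b → b < c → c < d → d < M + N → b′ < a′ → a′ < c′ → ¬ d′ < b′
  from-graph (inside _ _ p) _ (inside c< c′< q) _ a<b b<c _ _ _ a′<c′ _ =
    contradiction (subst (_ <_) (ascent⇒adjacent p q c< c′< (<-trans a<b b<c) a′<c′) b<c) (≤⇒≯ a<b)
  from-graph (inside _ a′< _) _ (outside c) (outside d) _ _ _ _ b′<a′ _ d′<b′ =
    contradiction (<-trans d′<b′ (<-trans b′<a′ a′<)) (≤⇒≯ (m≤m+n M (g d)))
  from-graph _ _ (outside c) (inside d< _ _) _ _ c<d = later c<d d<
  from-graph (outside a) (inside b< _ _) _ _ a<b = later a<b b<
  from-graph (outside a) (outside b) (inside c< _ _) _ _ b<c = later b<c c<
  from-graph (outside a) (outside b) (outside c) (outside d) a<b b<c c<d d<N b′<a′ a′<c′ d′<b′ =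
    g-avoids (cancel a<b) (cancel b<c) (cancel c<d) (cancel d<N) (cancel b′<a′) (cancel a′<c′) (cancel d′<b′)
    where
    cancel : ∀ {x y} → M + x < M + y → x < y
    cancel = +-cancelˡ-< M _ _

▷-admissible : ∀ k {g N} → Admissible N g → Admissible (suc k * 2 + N) (k ▷ g)
▷-admissible k {g} adm = record
  { bounded    = ▷-bounded k G.bounded
  ; involutive = ▷-involutive k G.involutive
  ; descent    = ▷-descent k G.descent
  ; ascent     = ▷-ascent k G.ascent
  ; no-3241    = ▷-no-3241 k G.no-3241
  }
  where module G = Admissible adm

-- The first block of an admissible word.

module _ {N f} (adm : Admissible N f) (2≤N : 2 ≤ N) where
  open Admissible adm

  -- The letter 0 stands at position `f 0`, and a letter at an even position exceeds some neighbour.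
  f0-odd : ∃ λ k → f 0 ≡ suc (k * 2)
  f0-odd with f 0 in eq | parity? (f 0)
  ... | _ | odd k = k , refl
  ... | _ | even zero =
    contradiction (subst (f 1 <_) eq (descent 0 2≤N)) n≮0
  ... | _ | even (suc k) =
    contradiction
      (subst (f (suc (k * 2)) <_) (trans (cong f (sym eq)) (involutive 0<N))
        (ascent k (subst (_< N) eq (bounded 0<N))))
      n≮0
    where 0<N = ≤-trans (s≤s z≤n) 2≤N

module FirstBlock {N′ f} K (adm : Admissible (suc K * 2 + N′) f) (f0 : f 0 ≡ suc (K * 2)) where
  open Admissible adm

  M = suc K * 2

  in-range : ∀ {x} → x < M → x < M + N′
  in-range x<M = ≤-trans x<M (m≤m+n M N′)

  involutive′ : ∀ {x} → x < M → f (f x) ≡ x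
  involutive′ = involutive ∘ in-range

  f-last : f (suc (K * 2)) ≡ 0
  f-last = trans (cong f (sym f0)) (involutive′ z<s)

  nonzero : ∀ {x} → x < suc (K * 2) → 0 < f x
  nonzero x<m = n≢0⇒n>0 λ fx≡0 →
    <-irrefl (trans (sym (involutive′ (m<n⇒m<1+n x<m))) (trans (cong f fx≡0) f0)) x<m

  -- Otherwise two successive peaks, the valley between them and the final
  -- letter 0 of the block would form 3241.
  peak-step : ∀ {j} → j < K → f (suc j * 2) ≤ f (j * 2)
  peak-step {j} j<K = ≮⇒≥ λ fa<fc →
    no-3241 (n<1+n _) (n<1+n _) (s≤s (double-≤ j<K)) (in-range ≤-refl)
      (descent j (in-range (s≤s (s≤s (≤-trans (n≤1+n _) (<⇒≤ (double-< j<K)))))))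
      fa<fc
      (subst (_< f (suc (j * 2))) (sym f-last) (nonzero (s≤s (<⇒≤ (double-< j<K)))))

  peaks : ∀ {i} j → i ≤ j → j ≤ K → f (j * 2) ≤ f (i * 2)
  peaks zero    z≤n  _ = ≤-refl
  peaks (suc j) i≤1+j j<K with m≤n⇒m<n∨m≡n i≤1+j
  ... | inj₁ i<1+j = ≤-trans (peak-step j<K) (peaks j (s≤s⁻¹ i<1+j) (<⇒≤ j<K))
  ... | inj₂ refl  = ≤-refl

  peak-dominates : ∀ j {x} → j * 2 ≤ x → x < M → f x ≤ f (j * 2)
  peak-dominates j {x} j≤x x<M with parity? x
  ... | even i = peaks i (halve-≤ {j} j≤x) (s≤s⁻¹ (halve-< {i} x<M))
  ... | odd i  = ≤-trans (<⇒≤ (descent i (in-range x<M)))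
    (peaks i (s≤s⁻¹ (halve-< {j} (s≤s j≤x))) (s≤s⁻¹ (halve-< {i} (<-trans (n<1+n _) x<M))))

  closed : ∀ {x} → x < M → f x < M
  closed x<M = s≤s (subst (f _ ≤_) f0 (peak-dominates 0 z≤n x<M))

  -- The invariant for filling the block from both ends. When `j + suc j′ ≡ K`, counting shows that
  -- positions 0 to 2j take exactly the 2j+1 largest values of the block; the second half is the
  -- mirror image under inversion.
  Outer : ℕ → ℕ → Set
  Outer j j′ = (∀ {x} → x ≤ j * 2 → suc j′ * 2 < f x) ×
               (∀ {z} → suc j′ * 2 < z → z < M → f z ≤ j * 2)

  Inner : ℕ → ℕ → Set
  Inner j j′ = f (suc (j * 2)) ≡ suc (j′ * 2) × f (suc j * 2) ≡ suc j′ * 2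

  -- Beyond the letters already placed, the largest remaining value has to be
  -- the first remaining peak.
  outer⇒inner : ∀ {j j′} → j + suc j′ ≡ K → Outer j j′ → Inner j j′
  outer⇒inner {j} {j′} e (small , large) = valley , peak
    where
    p = suc j * 2
    y = suc j′ * 2
    p<M : p < M
    p<M = s≤s (≤-trans (inner-bound e) (n≤1+n _))
    y<M : y < M
    y<M = s≤s (≤-trans (inner-bound (swap-sum j j′ e)) (n≤1+n _))
    upper : f p ≤ y
    upper = ≮⇒≥ λ y<fp → contradiction
      (subst (_≤ j * 2) (involutive′ p<M) (large y<fp (closed p<M)))
      (<⇒≱ (m<n⇒m<1+n (n<1+n _)))
    fy> : j * 2 < f y
    fy> = ≰⇒> λ fy≤ → <-irrefl (sym (involutive′ y<M)) (small fy≤)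
    -- The value `y` stands at position `f y`, after 2j: either at the valley just before `p`, or no
    -- earlier than `p`, where `p` dominates.
    lower : f (f y) ≤ f p
    lower with m≤n⇒m<n∨m≡n fy>
    ... | inj₁ p≤fy = peak-dominates (suc j) p≤fy (closed y<M)
    ... | inj₂ eq   = subst (λ x → f x ≤ f p) eq (<⇒≤ (ascent j (in-range p<M)))
    peak : f p ≡ y
    peak = ≤-antisym upper (subst (_≤ f p) (involutive′ y<M) lower)
    fy≡p : f y ≡ p
    fy≡p = trans (cong f (sym peak)) (involutive′ p<M)
    v = suc (j′ * 2)
    v<M : v < M
    v<M = <-trans (n<1+n v) y<M
    -- The mirror valley `v` precedes `y`, whose letter is now known to be `p`. This bounds `f v` by
    -- 2j+1, and `small` excludes anything less.
    fv≡ : f v ≡ suc (j * 2)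
    fv≡ = ≤-antisym (s≤s⁻¹ (subst (f v <_) fy≡p (ascent j′ (in-range y<M))))
      (≰⇒> λ fv≤ → <-asym (n<1+n v) (subst (y <_) (involutive′ v<M) (small fv≤)))
    valley : f (suc (j * 2)) ≡ v
    valley = trans (cong f (sym fv≡)) (involutive′ v<M)

  -- The pair just determined extends the known positions by two on the left and, through
  -- involutivity, by two on the right.
  advance : ∀ {j j′} → j + suc (suc j′) ≡ K → Outer j (suc j′) → Outer (suc j) j′
  advance {j} {j′} e outer@(small , large) with outer⇒inner e outer
  ... | valley , peak = small′ , large′
    where
    v<M : suc (suc j′ * 2) < M
    v<M = s≤s (s≤s (≤-trans (n≤1+n _) (≤-trans (n≤1+n _) (inner-bound (swap-sum j (suc j′) e)))))
    p<M : suc j * 2 < M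
    p<M = s≤s (≤-trans (inner-bound e) (n≤1+n _))
    small′ : ∀ {x} → x ≤ suc j * 2 → suc j′ * 2 < f x
    small′ x≤ with m≤n⇒m<n∨m≡n x≤
    ... | inj₂ refl = subst (suc j′ * 2 <_) (sym peak) (m<n⇒m<1+n (n<1+n _))
    ... | inj₁ x< with m≤n⇒m<n∨m≡n (s≤s⁻¹ x<)
    ...   | inj₂ refl = subst (suc j′ * 2 <_) (sym valley) (n<1+n _)
    ...   | inj₁ x<′  = <-trans (m<n⇒m<1+n (n<1+n _)) (small (s≤s⁻¹ x<′))
    large′ : ∀ {z} → suc j′ * 2 < z → z < M → f z ≤ suc j * 2
    large′ z> z<M with m≤n⇒m<n∨m≡n z>
    ... | inj₂ refl = ≤-trans
      (≤-reflexive (trans (cong f (sym valley)) (involutive′ (<-trans (n<1+n _) p<M)))) (n≤1+n _)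
    ... | inj₁ z>′ with m≤n⇒m<n∨m≡n z>′
    ...   | inj₂ refl = ≤-reflexive (trans (cong f (sym peak)) (involutive′ p<M))
    ...   | inj₁ z>″ = ≤-trans (large z>″ z<M) (≤-trans (n≤1+n _) (n≤1+n _))

  -- Induction from the ends inwards, starting from the letters at positions 0 and 2K+1 alone.
  outer : ∀ j {j′} → j + suc j′ ≡ K → Outer j j′
  outer zero    {j′} refl = (λ { z≤n → ≤-reflexive (sym f0) })
    , λ z> z<M → ≤-reflexive (trans (cong f (≤-antisym (s≤s⁻¹ z<M) z>)) f-last)
  outer (suc j) {j′} e = advance e′ (outer j e′)
    where e′ = trans (+-suc j (suc j′)) e

  inner : ∀ {j j′} → j + suc j′ ≡ K → Inner j j′
  inner {j} e = outer⇒inner e (outer j e)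

  rest : ℕ → ℕ
  rest x = f (M + x) ∸ M

  -- The subtraction is never truncated: a value below `M` would, by `closed` and involutivity, put
  -- the position `M + x` below `M`.
  rest-spec : ∀ {x} → x < N′ → M + rest x ≡ f (M + x)
  rest-spec {x} x<N′ = m+[n∸m]≡n (≮⇒≥ λ l →
    ≤⇒≯ (m≤m+n M x) (subst (_< M) (involutive (+-monoʳ-< M x<N′)) (closed l)))

  decompose : ∀ {x} → x < M + N′ → (K ▷ rest) x ≡ f x
  decompose {x} = from-graph (graph K rest x)
    where
    from-graph : ∀ {x y} → Graph K (λ y → M + rest y) x y → x < M + N′ → y ≡ f x
    from-graph first      _ = sym f0
    from-graph (inner₁ e) _ = sym (proj₁ (inner e))
    from-graph (inner₂ e) _ = sym (proj₂ (inner e))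
    from-graph last       _ = sym f-last
    from-graph (beyond x) l = rest-spec (+-cancelˡ-< M x N′ l)

  -- Translation by `M` preserves order, and `M` is even, so peaks and valleys keep their roles.
  rest-admissible : Admissible N′ rest
  rest-admissible = record
    { bounded    = rest-bounded
    ; involutive = λ {x} l → +-cancelˡ-≡ M _ _ (trans (rest-spec (rest-bounded l))
        (trans (cong f (rest-spec l)) (involutive (+-monoʳ-< M l))))
    ; descent    = λ j l → reflect-< l (<-trans (n<1+n _) l)
        (subst₂ _<_ (cong f (double-+ 1 K j)) (cong f (double-+ 0 K j))
          (descent (suc K + j) (subst (_< M + N′) (sym (double-+ 1 K j)) (+-monoʳ-< M l))))
    ; ascent     = λ j l → reflect-< (<-trans (n<1+n _) l) l
        (subst₂ _<_ (cong f (double-+ 1 K j)) (cong f (double-+ 2 K j))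
          (ascent (suc K + j) (subst (_< M + N′) (sym (double-+ 2 K j)) (+-monoʳ-< M l))))
    ; no-3241    = λ a<b b<c c<d d<N′ fb<fa fa<fc fd<fb →
        let c<N′ = <-trans c<d d<N′; b<N′ = <-trans b<c c<N′; a<N′ = <-trans a<b b<N′ in
        no-3241 (+-monoʳ-< M a<b) (+-monoʳ-< M b<c) (+-monoʳ-< M c<d) (+-monoʳ-< M d<N′)
          (preserve-< b<N′ a<N′ fb<fa) (preserve-< a<N′ c<N′ fa<fc) (preserve-< d<N′ b<N′ fd<fb)
    }
    where
    rest-bounded : ∀ {x} → x < N′ → rest x < N′
    rest-bounded {x} l = +-cancelˡ-< M _ _ (subst (_< M + N′) (sym (rest-spec l)) (bounded (+-monoʳ-< M l)))
    preserve-< : ∀ {x y} → x < N′ → y < N′ → rest x < rest y → f (M + x) < f (M + y)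
    preserve-< x< y< l = subst₂ _<_ (rest-spec x<) (rest-spec y<) (+-monoʳ-< M l)
    reflect-< : ∀ {x y} → x < N′ → y < N′ → f (M + x) < f (M + y) → rest x < rest y
    reflect-< x< y< l = +-cancelˡ-< M _ _ (subst₂ _<_ (sym (rest-spec x<)) (sym (rest-spec y<)) l)

-- Coding sequences of blocks by bits.

-- A bit tells whether the next pair of positions enlarges the current block,
-- of half-length k + 1, or starts a new one.
blocks : ∀ {n} → ℕ → Vec Bool n → ℕ → ℕ
blocks k []           = k ▷ id
blocks k (true ∷ bs)  = blocks (suc k) bs
blocks k (false ∷ bs) = k ▷ blocks 0 bs

-- The length of the current block so far, plus `n` undecided pairs, plus `δ` (0 or 1) for a
-- trailing fixed point.
size : ℕ → ℕ → ℕ → ℕ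
size δ k n = suc k * 2 + (n * 2 + δ)

size-suc : ∀ δ k n → size δ (suc k) n ≡ size δ k (suc n)
size-suc δ k n = sym (x∙yz≈y∙xz (suc k * 2) 2 (n * 2 + δ))

id-admissible : ∀ {δ} → δ ≤ 1 → Admissible δ id
id-admissible δ≤1 = record
  { bounded    = id
  ; involutive = λ _ → refl
  ; descent    = λ _ l → contradiction (≤-trans l δ≤1) (≤⇒≯ (s≤s z≤n))
  ; ascent     = λ _ l → contradiction (≤-trans l δ≤1) (≤⇒≯ (s≤s z≤n))
  ; no-3241    = λ a<b _ _ _ b<a → contradiction b<a (<-asym a<b)
  }

blocks-admissible : ∀ {δ} → δ ≤ 1 → ∀ {n} k (bs : Vec Bool n) → Admissible (size δ k n) (blocks k bs)
blocks-admissible δ≤1 k []           = ▷-admissible k (id-admissible δ≤1)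
blocks-admissible {δ} δ≤1 {suc n} k (true ∷ bs) =
  subst (λ N → Admissible N (blocks (suc k) bs)) (size-suc δ k n) (blocks-admissible δ≤1 (suc k) bs)
blocks-admissible δ≤1 k (false ∷ bs) = ▷-admissible k (blocks-admissible δ≤1 0 bs)

blocks-first : ∀ {n} k (bs : Vec Bool n) → suc (k * 2) ≤ blocks k bs 0
blocks-first k []           = ≤-refl
blocks-first k (true ∷ bs)  = ≤-trans (m≤n+m _ 2) (blocks-first (suc k) bs)
blocks-first k (false ∷ bs) = ≤-refl

-- The first letter reveals the bit: closing the block makes it 2k+1, enlarging it makes it at least
-- 2k+3.
blocks-injective : ∀ δ {n} k (bs cs : Vec Bool n) →
  (∀ {x} → x < size δ k n → blocks k bs x ≡ blocks k cs x) → bs ≡ cs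
blocks-injective δ k []           []           _  = refl
blocks-injective δ {suc n} k (true ∷ bs) (true ∷ cs) eq =
  cong (true ∷_) (blocks-injective δ (suc k) bs cs (λ {x} → eq ∘ subst (x <_) (size-suc δ k n)))
blocks-injective δ k (true ∷ bs)  (false ∷ cs) eq =
  contradiction (eq z<s) (>⇒≢ (≤-trans (n≤1+n _) (blocks-first (suc k) bs)))
blocks-injective δ k (false ∷ bs) (true ∷ cs)  eq =
  contradiction (eq z<s) (<⇒≢ (≤-trans (n≤1+n _) (blocks-first (suc k) cs)))
blocks-injective δ {suc n} k (false ∷ bs) (false ∷ cs) eq =
  cong (false ∷_) (blocks-injective δ 0 bs cs λ {x} x< → +-cancelˡ-≡ (suc k * 2) _ _
    (trans (sym (below-beyond k x)) (trans (eq (+-monoʳ-< (suc k * 2) x<)) (below-beyond k x))))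

▷-cong : ∀ k {g h N} → (∀ {x} → x < N → g x ≡ h x) →
         ∀ {x} → x < suc k * 2 + N → (k ▷ g) x ≡ (k ▷ h) x
▷-cong k {g} {h} {N} g≗h {x} = from-graph (graph k h x)
  where
  from-graph : ∀ {x y} → Graph k (λ y → suc k * 2 + h y) x y → x < suc k * 2 + N → (k ▷ g) x ≡ y
  from-graph first      _ = refl
  from-graph (inner₁ e) _ = graph⇒≡ {k} {g} (inner₁ e)
  from-graph (inner₂ e) _ = graph⇒≡ {k} {g} (inner₂ e)
  from-graph last       _ = graph⇒≡ {k} {g} last
  from-graph (beyond x) l = trans (graph⇒≡ {k} {g} (beyond x))
    (cong (suc k * 2 +_) (g≗h (+-cancelˡ-< (suc k * 2) x N l)))

-- The true first block has half-length `K + 1` with `k ≤ K`. If `k < K` the next bit is `true`; if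
-- equal, the block closes and the remainder is coded recursively.
blocks-surjective : ∀ {δ} → δ ≤ 1 → ∀ n k {f} → Admissible (size δ k n) f → suc (k * 2) ≤ f 0 →
  ∃ λ (bs : Vec Bool n) → ∀ {x} → x < size δ k n → blocks k bs x ≡ f x
blocks-surjective {δ} δ≤1 n k {f} adm f0≥ with f0-odd adm (s≤s (s≤s z≤n))
... | K , f0 with m≤n⇒m<n∨m≡n (halve-≤ {k} {K} (s≤s⁻¹ (subst (suc (k * 2) ≤_) f0 f0≥)))
-- With no pair left, a longer block does not fit, since `δ ≤ 1`.
blocks-surjective {δ} δ≤1 zero k {f} adm f0≥ | K , f0 | inj₁ k<K =
  contradiction (+-cancelˡ-≤ (suc k * 2) 2 δ (subst (_≤ size δ k 0) (+-comm 2 (suc k * 2))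
      (≤-trans (s≤s (s≤s (double-≤ k<K))) (subst (_< size δ k 0) f0 (Admissible.bounded adm z<s)))))
    (<⇒≱ (s≤s δ≤1))
blocks-surjective {δ} δ≤1 (suc n) k {f} adm f0≥ | K , f0 | inj₁ k<K =
  let bs , eq = blocks-surjective δ≤1 n (suc k) (subst (λ N → Admissible N f) (sym (size-suc δ k n)) adm)
                  (subst (suc (suc k * 2) ≤_) (sym f0) (s≤s (double-≤ k<K)))
  in true ∷ bs , λ {x} → eq ∘ subst (x <_) (sym (size-suc δ k n))
blocks-surjective {δ} δ≤1 zero k {f} adm f0≥ | K , f0 | inj₂ refl =
  [] , λ l → trans (▷-cong k (λ x<δ → sym (rest≗id x<δ)) l) (decompose l)
  where
  open FirstBlock k adm f0
  rest≗id : ∀ {x} → x < δ → rest x ≡ x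
  rest≗id x<δ = trans (n<1⇒n≡0 (≤-trans (Admissible.bounded rest-admissible x<δ) δ≤1))
    (sym (n<1⇒n≡0 (≤-trans x<δ δ≤1)))
blocks-surjective {δ} δ≤1 (suc n) k {f} adm f0≥ | K , f0 | inj₂ refl =
  let bs , eq = blocks-surjective δ≤1 n 0 rest-admissible
                  (≤-trans (s≤s z≤n) (Admissible.descent rest-admissible 0 (s≤s (s≤s z≤n))))
  in false ∷ bs , λ l → trans (▷-cong k eq l) (decompose l)
  where
  open FirstBlock k adm f0

-- Pattern containment and its symmetry under inversion.

step-mono : ∀ {k} (F : Fin (suc k) → ℕ) → (∀ i → F (inject₁ i) < F (Fin.suc i)) →
            ∀ a b → a Fin.< b → F a < F b
step-mono F step 0F (Fin.suc 0F) _ = step 0F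
step-mono {suc k} F step 0F (Fin.suc b@(Fin.suc _)) _ =
  <-trans (step 0F) (step-mono (F ∘ Fin.suc) (step ∘ Fin.suc) 0F b z<s)
step-mono {suc k} F step (Fin.suc a) (Fin.suc b) (s≤s a<b) =
  step-mono (F ∘ Fin.suc) (step ∘ Fin.suc) a b a<b

perm-injective : ∀ {n} (π : Permutation′ n) {i j} → π ⟨$⟩ʳ i ≡ π ⟨$⟩ʳ j → i ≡ j
perm-injective π eq = trans (sym (Perm.inverseˡ π)) (trans (cong (π ⟨$⟩ˡ_) eq) (Perm.inverseˡ π))

-- Comparing consecutive positions and consecutive values suffices: trichotomy turns preservation of
-- the order into an equivalence.
contains-by-steps : ∀ {k n} (τ : Permutation′ (suc k)) (π : Permutation′ n) (ι : Fin (suc k) → Fin n) →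
  (∀ i → ι (inject₁ i) Fin.< ι (Fin.suc i)) →
  (∀ i → π ⟨$⟩ʳ ι (τ ⟨$⟩ˡ inject₁ i) Fin.< π ⟨$⟩ʳ ι (τ ⟨$⟩ˡ Fin.suc i)) →
  Contains τ π
contains-by-steps τ π ι positions values =
  ι , step-mono (toℕ ∘ ι) positions , λ a b → mk⇔ (reflects a b) (preserves a b)
  where
  preserves : ∀ a b → τ ⟨$⟩ʳ a Fin.< τ ⟨$⟩ʳ b → π ⟨$⟩ʳ ι a Fin.< π ⟨$⟩ʳ ι b
  preserves a b l = subst₂ (λ a b → π ⟨$⟩ʳ ι a Fin.< π ⟨$⟩ʳ ι b) (Perm.inverseˡ τ) (Perm.inverseˡ τ)
    (step-mono (λ p → toℕ (π ⟨$⟩ʳ ι (τ ⟨$⟩ˡ p))) values _ _ l)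
  reflects : ∀ a b → π ⟨$⟩ʳ ι a Fin.< π ⟨$⟩ʳ ι b → τ ⟨$⟩ʳ a Fin.< τ ⟨$⟩ʳ b
  reflects a b l with Fin.<-cmp (τ ⟨$⟩ʳ a) (τ ⟨$⟩ʳ b)
  ... | tri< τa<τb _ _ = τa<τb
  ... | tri≈ _ τa≡τb _ = contradiction l (<-irrefl (cong (λ a → toℕ (π ⟨$⟩ʳ ι a)) (perm-injective τ τa≡τb)))
  ... | tri> _ _ τb<τa = contradiction l (<-asym (preserves b a τb<τa))

contains-resp-≈ : ∀ {k n} {τ τ′ : Permutation′ k} {π π′ : Permutation′ n} →
  τ Perm.≈ τ′ → π Perm.≈ π′ → Contains τ π → Contains τ′ π′
contains-resp-≈ τ≈τ′ π≈π′ (ι , mono , iff) = ι , mono , λ a b →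
  subst₂ _⇔_ (cong₂ Fin._<_ (π≈π′ (ι a)) (π≈π′ (ι b))) (cong₂ Fin._<_ (τ≈τ′ a) (τ≈τ′ b)) (iff a b)

-- Transposing the diagram turns the values of an occurrence, in increasing order, into its
-- positions.
contains-flip : ∀ {k n} {τ : Permutation′ k} {π : Permutation′ n} →
  Contains τ π → Contains (flip τ) (flip π)
contains-flip {τ = τ} {π} (ι , mono , iff) = (λ a → π ⟨$⟩ʳ ι (τ ⟨$⟩ˡ a))
  , (λ a b a<b → Equivalence.from (iff _ _)
      (subst₂ Fin._<_ (sym (Perm.inverseʳ τ)) (sym (Perm.inverseʳ τ)) a<b))
  , λ a b → mk⇔
      (λ l → ι-reflects _ _ (subst₂ Fin._<_ (Perm.inverseˡ π) (Perm.inverseˡ π) l))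
      (λ l → subst₂ Fin._<_ (sym (Perm.inverseˡ π)) (sym (Perm.inverseˡ π)) (mono _ _ l))
  where
  ι-reflects : ∀ a b → ι a Fin.< ι b → a Fin.< b
  ι-reflects a b l with Fin.<-cmp a b
  ... | tri< a<b _ _ = a<b
  ... | tri≈ _ refl _ = contradiction l (<-irrefl refl)
  ... | tri> _ _ b<a = contradiction l (<-asym (mono b a b<a))

-- Permutations as admissible functions.

∤odd : ∀ j → ¬ 2 ∣ suc (j * 2)
∤odd j 2∣ with ∣1⇒≡1 (∣m+n∣m⇒∣n (subst (2 ∣_) (+-comm 1 (j * 2)) 2∣) (n∣m*n j))
... | ()

module _ {N} (π : Permutation′ N) (f : ℕ → ℕ) (π≗f : ∀ i → toℕ (π ⟨$⟩ʳ i) ≡ f (toℕ i)) where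

  RAI⇒Admissible : RAI N p3241 p4213 π → Admissible N f
  RAI⇒Admissible (rev-alt , inv , avoids , _) = record
    { bounded    = λ l → subst (_< N) (value l) (toℕ<n _)
    ; involutive = λ l → trans (cong f (sym (value l))) (trans (sym (π≗f _))
        (trans (cong toℕ (trans (inv _) (Perm.inverseˡ π))) (toℕ-fromℕ< l)))
    ; descent    = λ j l → let l′ = <-trans (n<1+n _) l in
        subst₂ _<_ (value l) (value l′)
          (Equivalence.from (rev-alt (fromℕ< l′) (fromℕ< l) (successor l′ l))
            (subst (λ x → ¬ 2 ∣ suc x) (sym (toℕ-fromℕ< l′)) (∤odd j)))
    ; ascent     = λ j l → let l′ = <-trans (n<1+n _) l in
        -- Reverse alternation only excludes a descent here; injectivity makes the inequality
        -- strict.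
        ≤∧≢⇒<
          (≮⇒≥ λ f< → Equivalence.to (rev-alt (fromℕ< l′) (fromℕ< l) (successor l′ l))
            (subst₂ _<_ (sym (value l)) (sym (value l′)) f<)
            (subst (λ x → 2 ∣ suc x) (sym (toℕ-fromℕ< l′)) (n∣m*n (suc j))))
          λ f≡ → <-irrefl
            (trans (sym (toℕ-fromℕ< l′)) (trans (cong toℕ (perm-injective π {fromℕ< l′} {fromℕ< l}
              (toℕ-injective (trans (value l′) (trans f≡ (sym (value l))))))) (toℕ-fromℕ< l)))
            (n<1+n _)
    ; no-3241    = λ a<b b<c c<d d<N fb<fa fa<fc fd<fb →
        let c<N = <-trans c<d d<N; b<N = <-trans b<c c<N; a<N = <-trans a<b b<N in
        avoids (contains-by-steps p3241 π
          (lookup (fromℕ< a<N ∷ fromℕ< b<N ∷ fromℕ< c<N ∷ fromℕ< d<N ∷ []))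
          (λ { 0F → position a<N b<N a<b ; 1F → position b<N c<N b<c ; 2F → position c<N d<N c<d })
          -- In increasing order of value, the pattern letters stand at `d`, `b`, `a`, `c`.
          (λ { 0F → values d<N b<N fd<fb ; 1F → values b<N a<N fb<fa ; 2F → values a<N c<N fa<fc }))
    }
    where
    value : ∀ {x} (l : x < N) → toℕ (π ⟨$⟩ʳ fromℕ< l) ≡ f x
    value l = trans (π≗f _) (cong f (toℕ-fromℕ< l))
    successor : ∀ {x} (l′ : x < N) (l : suc x < N) → toℕ (fromℕ< l) ≡ suc (toℕ (fromℕ< l′))
    successor l′ l = trans (toℕ-fromℕ< l) (cong suc (sym (toℕ-fromℕ< l′)))
    position : ∀ {x y} (l : x < N) (l′ : y < N) → x < y → fromℕ< l Fin.< fromℕ< l′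
    position l l′ = subst₂ _<_ (sym (toℕ-fromℕ< l)) (sym (toℕ-fromℕ< l′))
    values : ∀ {x y} (l : x < N) (l′ : y < N) → f x < f y → π ⟨$⟩ʳ fromℕ< l Fin.< π ⟨$⟩ʳ fromℕ< l′
    values l l′ = subst₂ _<_ (sym (value l)) (sym (value l′))

  -- An occurrence of 4213 inverts to one of 3241 in `flip π`, which agrees with `π`.
  Admissible⇒RAI : Admissible N f → RAI N p3241 p4213 π
  Admissible⇒RAI adm = rev-alt , inv , avoids
    , avoids ∘ contains-resp-≈ {τ = flip p4213} {p3241} {flip π} {π} (λ _ → refl) (sym ∘ inv)
      ∘ contains-flip {τ = p4213} {π}
    where
    open Admissible adm
    inv : Involution π
    inv i = trans (sym (Perm.inverseˡ π)) (cong (π ⟨$⟩ˡ_) (toℕ-injective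
      (trans (π≗f _) (trans (cong f (π≗f i)) (involutive (toℕ<n i))))))
    pattern-order : ∀ {i j} → π ⟨$⟩ʳ i Fin.< π ⟨$⟩ʳ j → f (toℕ i) < f (toℕ j)
    pattern-order = subst₂ _<_ (π≗f _) (π≗f _)
    avoids : Avoids p3241 π
    avoids (ι , mono , iff) = no-3241
      (mono 0F 1F (s≤s z≤n)) (mono 1F 2F (s≤s (s≤s z≤n))) (mono 2F 3F (s≤s (s≤s (s≤s z≤n))))
      (toℕ<n (ι 3F))
      (pattern-order (Equivalence.from (iff 1F 0F) (s≤s (s≤s z≤n))))
      (pattern-order (Equivalence.from (iff 0F 2F) (s≤s (s≤s (s≤s z≤n)))))
      (pattern-order (Equivalence.from (iff 3F 1F) (s≤s z≤n)))
    rev-alt : ReverseAlternating π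
    rev-alt i j eq with toℕ i in i≡ | parity? (toℕ i)
    ... | _ | even a = mk⇔ (λ _ → ∤odd a) λ _ →
      subst₂ _<_ (trans (cong f (sym eq)) (sym (π≗f j))) (trans (cong f (sym i≡)) (sym (π≗f i)))
        (descent a (subst (_< N) eq (toℕ<n j)))
    ... | _ | odd a = mk⇔
      (λ l → contradiction (subst₂ _<_ (trans (π≗f j) (cong f eq)) (trans (π≗f i) (cong f i≡)) l)
        (<-asym (ascent a (subst (_< N) eq (toℕ<n j)))))
      (λ ∤ → contradiction (n∣m*n (suc a)) ∤)

-- The value beyond `N` is an arbitrary default; admissibility looks only below `N`.
extend : ∀ {N} → Permutation′ N → ℕ → ℕ
extend {N} π x with x <? N
... | yes l = toℕ (π ⟨$⟩ʳ fromℕ< l)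
... | no _  = x

extend-toℕ : ∀ {N} (π : Permutation′ N) i → toℕ (π ⟨$⟩ʳ i) ≡ extend π (toℕ i)
extend-toℕ {N} π i with toℕ i <? N
... | yes l = cong (λ i → toℕ (π ⟨$⟩ʳ i)) (sym (fromℕ<-toℕ i l))
... | no ≮N = contradiction (toℕ<n i) ≮N

module _ {N f} (adm : Admissible N f) where
  open Admissible adm

  restrict : Permutation′ N
  restrict = permutation to to to-involutive to-involutive
    where
    to : Fin N → Fin N
    to i = fromℕ< (bounded (toℕ<n i))
    to-involutive : ∀ i → to (to i) ≡ i
    to-involutive i = toℕ-injective (trans (toℕ-fromℕ< _)
      (trans (cong f (toℕ-fromℕ< _)) (involutive (toℕ<n i))))

  restrict-toℕ : ∀ i → toℕ (restrict ⟨$⟩ʳ i) ≡ f (toℕ i)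
  restrict-toℕ i = toℕ-fromℕ< _

-- Counting the bit vectors.

Bool^n↔Fin : ∀ n → Vec Bool n ↔ Fin (2 ^ n)
Bool^n↔Fin zero    = mk↔ₛ′ (λ _ → 0F) (λ _ → []) (λ { 0F → refl ; (Fin.suc ()) }) (λ { [] → refl })
Bool^n↔Fin (suc n) = ↔-sym *↔× ↔-∘ ((↔-sym 2↔Bool ×-↔ Bool^n↔Fin n) ↔-∘ uncons)
  where
  uncons : Vec Bool (suc n) ↔ (Bool × Vec Bool n)
  uncons = mk↔ₛ′ (λ { (b ∷ bs) → b , bs }) (λ { (b , bs) → b ∷ bs })
    (λ _ → refl) (λ { (_ ∷ _) → refl })

-- The first of the n+1 pairs always opens a block, so `n` bits remain.
RAI-3241-cardinality : ∀ {δ} → δ ≤ 1 → ∀ n → HasCardinality (RAI (size δ 0 n) p3241 p4213) (2 ^ n)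
RAI-3241-cardinality {δ} δ≤1 n =
  Compose.inverse (Symmetry.inverse (Bijection⇒Inverse bits⤖members)) (Bool^n↔Fin n)
  where
  P = RAI (size δ 0 n) p3241 p4213
  word : (bs : Vec Bool n) → ∃ P
  word bs = restrict adm , Admissible⇒RAI (restrict adm) (blocks 0 bs) (restrict-toℕ adm) adm
    where adm = blocks-admissible δ≤1 0 bs
  bits⤖members : Bijection (setoid (Vec Bool n)) (members P)
  bits⤖members = record
    { to   = word
    ; cong = λ { refl _ → refl }
    ; bijective = injective , surjective
    }
    where
    injective : ∀ {bs cs} → (∀ i → proj₁ (word bs) ⟨$⟩ʳ i ≡ proj₁ (word cs) ⟨$⟩ʳ i) → bs ≡ cs
    injective {bs} {cs} eq = blocks-injective δ 0 bs cs λ l →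
      subst (λ x → blocks 0 bs x ≡ blocks 0 cs x) (toℕ-fromℕ< l)
      (trans (sym (restrict-toℕ (blocks-admissible δ≤1 0 bs) (fromℕ< l)))
        (trans (cong toℕ (eq (fromℕ< l))) (restrict-toℕ (blocks-admissible δ≤1 0 cs) (fromℕ< l))))
    surjective : ∀ (π : ∃ P) → ∃ λ bs → ∀ {cs} → cs ≡ bs →
                 ∀ i → proj₁ (word cs) ⟨$⟩ʳ i ≡ proj₁ π ⟨$⟩ʳ i
    surjective (π , π∈P) =
      let adm = RAI⇒Admissible π (extend π) (extend-toℕ π) π∈P
          bs , eq = blocks-surjective δ≤1 n 0 adm
            (≤-trans (s≤s z≤n) (Admissible.descent adm 0 (s≤s (s≤s z≤n))))
      in bs , λ { refl i → toℕ-injective (trans (restrict-toℕ (blocks-admissible δ≤1 0 bs) i)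
                   (trans (eq (toℕ<n i)) (sym (extend-toℕ π i)))) }

-- Transfer by reverse-complement, the half-turn of the diagram.

reverse-complement : ∀ {n} → Permutation′ n → Permutation′ n
reverse-complement π = reverse ∘ₚ (π ∘ₚ reverse)

reverse-complement² : ∀ {n} (π : Permutation′ n) → reverse-complement (reverse-complement π) Perm.≈ π
reverse-complement² π i = trans (opposite-involutive _) (cong (π ⟨$⟩ʳ_) (opposite-involutive i))

opposite-mono : ∀ {n} {i j : Fin n} → i Fin.< j → opposite j Fin.< opposite i
opposite-mono {n} {i} {j} i<j =
  subst₂ _<_ (sym (opposite-prop j)) (sym (opposite-prop i)) (∸-monoʳ-< (s≤s i<j) (toℕ<n j))

opposite-< : ∀ {n} {i j : Fin n} → (opposite i Fin.< opposite j) ⇔ (j Fin.< i)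
opposite-< {i = i} {j} = mk⇔
  (subst₂ Fin._<_ (opposite-involutive j) (opposite-involutive i) ∘ opposite-mono) opposite-mono

contains-reverse-complement : ∀ {k n} {τ : Permutation′ k} {π : Permutation′ n} →
  Contains τ π → Contains (reverse-complement τ) (reverse-complement π)
contains-reverse-complement {τ = τ} {π} (ι , mono , iff) = opposite ∘ ι ∘ opposite
  , (λ a b a<b → opposite-mono (mono _ _ (opposite-mono a<b)))
  , λ a b → subst₂
      (λ i j → (opposite (π ⟨$⟩ʳ i) Fin.< opposite (π ⟨$⟩ʳ j)) ⇔
               (opposite (τ ⟨$⟩ʳ opposite a) Fin.< opposite (τ ⟨$⟩ʳ opposite b)))
      (sym (opposite-involutive _)) (sym (opposite-involutive _))
      (⇔-sym opposite-< ⇔-∘ (iff (opposite b) (opposite a) ⇔-∘ opposite-<))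

avoids-reverse-complement : ∀ {k n} {τ τ′ : Permutation′ k} {π : Permutation′ n} →
  reverse-complement τ′ Perm.≈ τ → Avoids τ π → Avoids τ′ (reverse-complement π)
avoids-reverse-complement {τ = τ} {τ′} {π} eq avoids =
  avoids
    ∘ contains-resp-≈ {τ = reverse-complement τ′} {τ} {reverse-complement (reverse-complement π)} {π}
        eq (reverse-complement² π)
    ∘ contains-reverse-complement {τ = τ′} {reverse-complement π}

involution-reverse-complement : ∀ {n} {π : Permutation′ n} → Involution π → Involution (reverse-complement π)
involution-reverse-complement inv i = cong opposite (inv (opposite i))

odd-sum : ∀ x y → ¬ 2 ∣ x + y → (¬ 2 ∣ x) ⇔ (2 ∣ y)
odd-sum x y ∤ = mk⇔ (to (parity? x) (parity? y) ∤) λ 2∣y 2∣x → ∤ (∣m∣n⇒∣m+n 2∣x 2∣y)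
  where
  to : ∀ {x y} → Parity x → Parity y → ¬ 2 ∣ x + y → ¬ 2 ∣ x → 2 ∣ y
  to (even a) _        _ ∤x = contradiction (n∣m*n a) ∤x
  to (odd a)  (even b) _ _  = n∣m*n b
  to (odd a)  (odd b)  ∤ _  = contradiction
    (subst (2 ∣_) (trans (*-distribʳ-+ 2 (suc a) b) (sym (+-suc (suc (a * 2)) (b * 2))))
      (n∣m*n (suc a + b)))
    ∤

module _ {N} {i j : Fin N} (j≡1+i : toℕ j ≡ suc (toℕ i)) where

  -- The half-turn sends the step at 1-based position p to the one at N - p, so its parity is kept
  -- for even `N` and switched for odd `N`.
  opposite-sum : suc (toℕ i) + suc (toℕ (opposite j)) ≡ N
  opposite-sum = trans (+-suc (suc (toℕ i)) _)
    (trans (cong₂ (λ x y → suc (x + y)) (sym j≡1+i) (opposite-prop j)) (m+[n∸m]≡n (toℕ<n j)))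

  opposite-successor : toℕ (opposite i) ≡ suc (toℕ (opposite j))
  opposite-successor = +-cancelˡ-≡ (suc (toℕ i)) _ _
    (trans (trans (cong (suc (toℕ i) +_) (opposite-prop i)) (m+[n∸m]≡n (toℕ<n i))) (sym opposite-sum))

  opposite-parity-even : 2 ∣ N → (2 ∣ suc (toℕ (opposite j))) ⇔ (2 ∣ suc (toℕ i))
  opposite-parity-even 2∣N = mk⇔
    (∣m+n∣m⇒∣n (subst (2 ∣_) (trans (sym opposite-sum) (+-comm (suc (toℕ i)) _)) 2∣N))
    (∣m+n∣m⇒∣n (subst (2 ∣_) (sym opposite-sum) 2∣N))

  opposite-parity-odd : ¬ 2 ∣ N → (¬ 2 ∣ suc (toℕ (opposite j))) ⇔ (2 ∣ suc (toℕ i))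
  opposite-parity-odd ∤N = odd-sum _ _ (∤N ∘ subst (2 ∣_) (trans (+-comm _ (suc (toℕ i))) opposite-sum))

≮⇔> : ∀ {n} (π : Permutation′ n) {i j} → i ≢ j →
      (¬ π ⟨$⟩ʳ i Fin.< π ⟨$⟩ʳ j) ⇔ (π ⟨$⟩ʳ j Fin.< π ⟨$⟩ʳ i)
≮⇔> π {i} {j} i≢j = mk⇔
  (λ ≮ → ≤∧≢⇒< (≮⇒≥ ≮) (i≢j ∘ sym ∘ perm-injective π ∘ toℕ-injective)) <-asym

module _ {N} (π : Permutation′ N) where

  private
    ρ = reverse-complement π

    opposite-≢ : ∀ {i j : Fin N} → toℕ j ≡ suc (toℕ i) → opposite i ≢ opposite j
    opposite-≢ e eq = <-irrefl (trans (cong toℕ (perm-injective reverse eq)) e) (n<1+n _)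

  ReverseAlternating-even : 2 ∣ N → ReverseAlternating π → ReverseAlternating ρ
  ReverseAlternating-even 2∣N rev-alt i j e =
    ¬-cong-⇔ (opposite-parity-even {i = i} {j} e 2∣N)
      ⇔-∘ (rev-alt (opposite j) (opposite i) (opposite-successor {i = i} {j} e) ⇔-∘ opposite-<)

  -- The parity switch is absorbed by negating both sides of the equivalence; by injectivity, a
  -- negated comparison of distinct positions is the reversed one.
  ReverseAlternating⇒Alternating-odd : ¬ 2 ∣ N → ReverseAlternating π → Alternating ρ
  ReverseAlternating⇒Alternating-odd ∤N rev-alt i j e =
    ¬-cong-⇔ (opposite-parity-odd {i = i} {j} e ∤N
        ⇔-∘ rev-alt (opposite j) (opposite i) (opposite-successor {i = i} {j} e))
      ⇔-∘ (⇔-sym (≮⇔> π (opposite-≢ e)) ⇔-∘ opposite-<)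

  Alternating⇒ReverseAlternating-odd : ¬ 2 ∣ N → Alternating π → ReverseAlternating ρ
  Alternating⇒ReverseAlternating-odd ∤N alt i j e =
    ¬-cong-⇔ (opposite-parity-odd {i = i} {j} e ∤N
        ⇔-∘ alt (opposite j) (opposite i) (opposite-successor {i = i} {j} e))
      ⇔-∘ (⇔-sym (≮⇔> π (opposite-≢ e ∘ sym)) ⇔-∘ opposite-<)

  avoids-2431-4132 : Involution π × Avoids p3241 π × Avoids p4213 π →
                     Involution ρ × Avoids p2431 ρ × Avoids p4132 ρ
  avoids-2431-4132 (inv , no-3241 , no-4213) = involution-reverse-complement {π = π} inv
    , avoids-reverse-complement {τ = p4213} {p2431} {π}
        (λ { 0F → refl ; 1F → refl ; 2F → refl ; 3F → refl }) no-4213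
    , avoids-reverse-complement {τ = p3241} {p4132} {π}
        (λ { 0F → refl ; 1F → refl ; 2F → refl ; 3F → refl }) no-3241

  avoids-3241-4213 : Involution π × Avoids p2431 π × Avoids p4132 π →
                     Involution ρ × Avoids p3241 ρ × Avoids p4213 ρ
  avoids-3241-4213 (inv , no-2431 , no-4132) = involution-reverse-complement {π = π} inv
    , avoids-reverse-complement {τ = p4132} {p3241} {π}
        (λ { 0F → refl ; 1F → refl ; 2F → refl ; 3F → refl }) no-4132
    , avoids-reverse-complement {τ = p2431} {p4213} {π}
        (λ { 0F → refl ; 1F → refl ; 2F → refl ; 3F → refl }) no-2431

reverse-complement-inverse : ∀ {n} {P Q : Pred (Permutation′ n) 0ℓ} →
  (∀ π → P π → Q (reverse-complement π)) → (∀ π → Q π → P (reverse-complement π)) →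
  Inverse (members P) (members Q)
reverse-complement-inverse P⇒Q Q⇒P = record
  { to        = λ (π , p) → reverse-complement π , P⇒Q π p
  ; from      = λ (π , q) → reverse-complement π , Q⇒P π q
  ; to-cong   = reverse-complement-cong
  ; from-cong = reverse-complement-cong
  ; inverse   = (λ {π} eq i → trans (reverse-complement-cong eq i) (reverse-complement² (proj₁ π) i))
              , (λ {π} eq i → trans (reverse-complement-cong eq i) (reverse-complement² (proj₁ π) i))
  }
  where
  reverse-complement-cong : ∀ {n} {f g : Fin n → Fin n} → (∀ i → f i ≡ g i) →
    ∀ i → opposite (f (opposite i)) ≡ opposite (g (opposite i))
  reverse-complement-cong eq i = cong opposite (eq (opposite i))

theorem9p1 : (n : ℕ) → 1 ≤ n →
    HasCardinality (RAI (2 * n) p2431 p4132) (2 ^ (n ∸ 1)) ×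
    HasCardinality (RAI (2 * n) p3241 p4213) (2 ^ (n ∸ 1)) ×
    HasCardinality (RAI (2 * n + 1) p3241 p4213) (2 ^ (n ∸ 1)) ×
    HasCardinality (AI (2 * n + 1) p2431 p4132) (2 ^ (n ∸ 1))
theorem9p1 (suc n) _ =
    Compose.inverse (reverse-complement-inverse
      (λ π (alt , rest) → ReverseAlternating-even π 2∣2n alt , avoids-3241-4213 π rest)
      (λ π (alt , rest) → ReverseAlternating-even π 2∣2n alt , avoids-2431-4132 π rest)) even-length
  , even-length
  , odd-length
  , Compose.inverse (reverse-complement-inverse
      (λ π (alt , rest) → Alternating⇒ReverseAlternating-odd π 2∤2n+1 alt , avoids-3241-4213 π rest)
      (λ π (alt , rest) → ReverseAlternating⇒Alternating-odd π 2∤2n+1 alt , avoids-2431-4132 π rest)) odd-length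
  where
  2∣2n : 2 ∣ 2 * suc n
  2∣2n = subst (2 ∣_) (*-comm (suc n) 2) (n∣m*n (suc n))
  2∤2n+1 : ¬ 2 ∣ 2 * suc n + 1
  2∤2n+1 = ∤odd (suc n) ∘ subst (2 ∣_) (trans (+-comm _ 1) (cong suc (*-comm 2 (suc n))))
  cardinality-subst : ∀ {M N} → M ≡ N → HasCardinality (RAI M p3241 p4213) (2 ^ n) →
                      HasCardinality (RAI N p3241 p4213) (2 ^ n)
  cardinality-subst = subst (λ N → HasCardinality (RAI N p3241 p4213) (2 ^ n))
  even-length : HasCardinality (RAI (2 * suc n) p3241 p4213) (2 ^ n)
  -- `size δ 0 n` unfolds to `suc n * 2 + δ`: here `δ` is 0, and in odd length it is 1.
  even-length = cardinality-subst (trans (+-identityʳ _) (*-comm (suc n) 2)) (RAI-3241-cardinality z≤n n)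
  odd-length : HasCardinality (RAI (2 * suc n + 1) p3241 p4213) (2 ^ n)
  odd-length = cardinality-subst (cong (_+ 1) (*-comm (suc n) 2)) (RAI-3241-cardinality ≤-refl n)
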